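{- (i) The $\mathcal{F}$-theory of the natural numbers, i.e. the set of sentences of $\mathcal{F}$ that are true in $(\mathbb{N},+,\cdot,<,0,1)$, is decidable. (ii) Every $\mathcal{F}$-formula is equivalent in $\mathbb{N}$ to a quantifier-free formula; that is, for every $\phi(x_1,\dots,x_m)$ in $\mathcal{F}$ there is a quantifier-free $\mathcal{L}$-formula $\psi(x_1,\dots,x_m)$ such that for all $n_1,\dots,n_m\in\mathbb{N}$, $(\mathbb{N},+,\cdot,<,0,1)\models\phi(n_1,\dots,n_m)$ if and only if $(\mathbb{N},+,\cdot,<,0,1)\models\psi(n_1,\dots,n_m)$.
   Context: Let $\mathcal{L}=\{+,\cdot,<,0,1\}$ be the language of ordered rings (first-order logic with equality), and let $\mathbb{N}=\{0,1,2,\dots\}$. Let $Q$ be a new quantifier symbol. If $\mathcal{M}=(M,<,\dots)$ is a linearly ordered $\mathcal{L}$-structure, then $\mathcal{M}\models Qx\,\phi$ is defined to mean $\mathcal{M}\models\exists z\,\forall x>z\ \phi$ (with $z$ a variable not occurring in $\phi$), i.e. "$\phi$ holds for all sufficiently large $x$"; $\phi$ may have other free variables, interpreted as parameters. $\mathcal{F}$ is the smallest collection of $\mathcal{L}$-formulas containing all quantifier-free formulas and closed under propositional connectives and under the quantifier $Q$ (i.e. if $\phi\in\mathcal{F}$ then $Qx\,\phi\in\mathcal{F}$ for each variable $x$). A sentence is a formula without free variables. -}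

module Defs where

open import Data.Fin using (Fin)
open import Data.Nat using (ℕ; suc; _+_; _*_; _<_)
open import Data.Product using (_×_; ∃-syntax)
open import Data.Sum using (_⊎_)
open import Data.Vec using (Vec; []; _∷_; lookup)
open import Function.Bundles using (_⇔_)
open import Relation.Binary.PropositionalEquality using (_≡_)
open import Relation.Nullary using (¬_)
open import Relation.Unary using (Pred)
open import Level using (0ℓ)

infixl 7 _*ᵗ_
infixl 6 _+ᵗ_
infix  5 _≈ᶠ_ _<ᶠ_
infix  4 ¬ᶠ_
infixr 3 _∧ᶠ_
infixr 2 _∨ᶠ_
infixr 1 _⇒ᶠ_ _⇔ᶠ_
infix  0 _⊨_

-- Variables are well-scoped de Bruijn indices: `Formula m` consists of the
-- formulas whose free variables are among m fixed ones.

data Term (m : ℕ) : Set where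
  var  : Fin m → Term m
  0ᵗ   : Term m
  1ᵗ   : Term m
  _+ᵗ_ : Term m → Term m → Term m
  _*ᵗ_ : Term m → Term m → Term m

-- The collection 𝓕: what is generated from the atomic formulas of the language
-- of ordered rings (with equality) by the propositional connectives and the
-- quantifier Q.  `Q φ` binds variable zero of φ.

data Formula (m : ℕ) : Set where
  _≈ᶠ_ : Term m → Term m → Formula m
  _<ᶠ_ : Term m → Term m → Formula m
  ¬ᶠ_  : Formula m → Formula m
  _∧ᶠ_ : Formula m → Formula m → Formula m
  _∨ᶠ_ : Formula m → Formula m → Formula m
  _⇒ᶠ_ : Formula m → Formula m → Formula m
  _⇔ᶠ_ : Formula m → Formula m → Formula m
  Q    : Formula (suc m) → Formula m

data QuantifierFree {m : ℕ} : Formula m → Set where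
  _≈ᶠ_ : ∀ s t → QuantifierFree (s ≈ᶠ t)
  _<ᶠ_ : ∀ s t → QuantifierFree (s <ᶠ t)
  ¬ᶠ_  : ∀ {φ} → QuantifierFree φ → QuantifierFree (¬ᶠ φ)
  _∧ᶠ_ : ∀ {φ ψ} → QuantifierFree φ → QuantifierFree ψ → QuantifierFree (φ ∧ᶠ ψ)
  _∨ᶠ_ : ∀ {φ ψ} → QuantifierFree φ → QuantifierFree ψ → QuantifierFree (φ ∨ᶠ ψ)
  _⇒ᶠ_ : ∀ {φ ψ} → QuantifierFree φ → QuantifierFree ψ → QuantifierFree (φ ⇒ᶠ ψ)
  _⇔ᶠ_ : ∀ {φ ψ} → QuantifierFree φ → QuantifierFree ψ → QuantifierFree (φ ⇔ᶠ ψ)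

⟦_⟧ : ∀ {m} → Term m → Vec ℕ m → ℕ
⟦ var i  ⟧ ν = lookup ν i
⟦ 0ᵗ     ⟧ ν = 0
⟦ 1ᵗ     ⟧ ν = 1
⟦ s +ᵗ t ⟧ ν = ⟦ s ⟧ ν + ⟦ t ⟧ ν
⟦ s *ᵗ t ⟧ ν = ⟦ s ⟧ ν * ⟦ t ⟧ ν

-- ν ⊨ φ: truth of φ in (ℕ, +, ·, <, 0, 1) under the assignment ν.

_⊨_ : ∀ {m} → Vec ℕ m → Formula m → Set
ν ⊨ s ≈ᶠ t = ⟦ s ⟧ ν ≡ ⟦ t ⟧ ν
ν ⊨ s <ᶠ t = ⟦ s ⟧ ν < ⟦ t ⟧ ν
ν ⊨ ¬ᶠ φ   = ¬ (ν ⊨ φ)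
ν ⊨ φ ∧ᶠ ψ = (ν ⊨ φ) × (ν ⊨ ψ)
ν ⊨ φ ∨ᶠ ψ = (ν ⊨ φ) ⊎ (ν ⊨ ψ)
ν ⊨ φ ⇒ᶠ ψ = (ν ⊨ φ) → (ν ⊨ ψ)
ν ⊨ φ ⇔ᶠ ψ = (ν ⊨ φ) ⇔ (ν ⊨ ψ)
ν ⊨ Q φ    = ∃[ z ] (∀ x → z < x → (x ∷ ν) ⊨ φ)

Sentence : Set
Sentence = Formula 0

-- The set of true sentences.  Its decidability is stated with the library's
-- `Relation.Unary.Decidable`: in axiom-free Agda an inhabitant is an actual
-- program deciding truth, not an instance of excluded middle.

TheoryOfℕ : Pred Sentence 0ℓ
TheoryOfℕ φ = [] ⊨ φ

{-# OPTIONS --safe #-}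
module Submission where

-- For a fixed assignment of the other variables, an atomic formula in x compares
-- two polynomials in x with coefficients in ℕ.  For large x the outcome is the
-- lexicographic comparison of the coefficients, the leading ones first, and that
-- is a quantifier-free condition on the other variables.  So the truth value of a
-- quantifier-free formula is eventually constant in x, with a quantifier-free
-- limit, and this limit is what Q asserts.

open import Defs
open import Data.Empty using (⊥-elim)
open import Data.Fin using (zero; suc)
open import Data.List using (List; []; _∷_; alignWith; foldr; map)
open import Data.Nat using (ℕ; suc; _+_; _*_; _<_; _⊔_; _≟_; _<?_)
open import Data.Nat.Properties
open import Data.Nat.Tactic.RingSolver using (solve-∀)
open import Data.Product using (_×_; _,_; ∃-syntax; proj₁; proj₂)
open import Data.Product.Function.NonDependent.Propositional using (_×-⇔_)
open import Data.Sum using (_⊎_; inj₁; inj₂)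
open import Data.Sum.Function.Propositional using (_⊎-⇔_)
open import Data.These as These using (These; this; that; these)
open import Data.Vec using (Vec; []; _∷_; lookup)
open import Function using (_∘_; const; id)
open import Function.Bundles using (_⇔_; mk⇔; Equivalence)
open import Function.Construct.Composition using (_⇔-∘_)
open import Function.Construct.Identity using (⇔-id)
open import Function.Construct.Symmetry using (⇔-sym)
open import Function.Related.TypeIsomorphisms using (→-cong-⇔; ¬-cong-⇔; Related-cong)
open import Level using (0ℓ)
open import Relation.Binary using (tri<; tri≈; tri>)
open import Relation.Binary.PropositionalEquality
open import Relation.Nullary using (Dec)
open import Relation.Nullary.Decidable as Dec using (_×-dec_; _⊎-dec_; _→-dec_; ¬?)
open import Relation.Unary using (Decidable; Pred)

private variable
  m : ℕ
  A B C : Set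

-- Properties of all sufficiently large numbers.

record Eventually (P : Pred ℕ 0ℓ) : Set where
  constructor beyond
  field
    bound : ℕ
    holds : ∀ x → bound < x → P x

eventually-zip : {P R S : Pred ℕ 0ℓ} →
  (∀ x → P x → R x → S x) → Eventually P → Eventually R → Eventually S
eventually-zip f (beyond z p) (beyond w r) = beyond (z ⊔ w) λ x z⊔w<x →
  f x (p x (≤-<-trans (m≤m⊔n z w) z⊔w<x)) (r x (≤-<-trans (m≤n⊔m z w) z⊔w<x))

eventually-map : {P R : Pred ℕ 0ℓ} → (∀ x → P x → R x) → Eventually P → Eventually R
eventually-map f (beyond z p) = beyond z λ x z<x → f x (p x z<x)

always : {P : Pred ℕ 0ℓ} → (∀ x → P x) → Eventually P
always p = beyond 0 λ x _ → p x

-- Some number always lies beyond the bound, so a claim not depending on `x` can be read off there.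
-- With `A` empty this turns an eventual contradiction into an actual one.
eventually-const : Eventually (const A) → A
eventually-const (beyond z p) = p (suc z) (n<1+n z)

-- Polynomial evaluation by Horner's rule.

horner : (A → ℕ) → List A → ℕ → ℕ
horner f as x = foldr (λ a v → f a + x * v) 0 as

horner-map : ∀ (f : A → ℕ) (g : B → A) bs x → horner f (map g bs) x ≡ horner (f ∘ g) bs x
horner-map f g []       x = refl
horner-map f g (b ∷ bs) x = cong (λ v → f (g b) + x * v) (horner-map f g bs x)

horner-cong : ∀ {f g : A → ℕ} → (∀ a → f a ≡ g a) → ∀ as x → horner f as x ≡ horner g as x
horner-cong f≗g []       x = refl
horner-cong f≗g (a ∷ as) x = cong₂ (λ u v → u + x * v) (f≗g a) (horner-cong f≗g as x)

horner-scale : ∀ k (f : A → ℕ) as x → horner (λ a → k * f a) as x ≡ k * horner f as x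
horner-scale k f []       x = sym (*-zeroʳ k)
horner-scale k f (a ∷ as) x =
  trans (cong (λ v → k * f a + x * v) (horner-scale k f as x))
        (distrib k (f a) x (horner f as x))
  where
  distrib : ∀ k u x v → k * u + x * (k * v) ≡ k * (u + x * v)
  distrib = solve-∀

-- Adding coefficientwise adds the values, an absent coefficient counting as 0. The generality in
-- `f`, `g` and `e` covers both the sum `_⊕_` and each component of `paired`.
horner-alignWith : ∀ (f : A → ℕ) (g : B → ℕ) (e : C → ℕ) (h : These A B → C) →
  (∀ t → e (h t) ≡ These.fold f g (λ a b → f a + g b) t) →
  ∀ as bs x → horner e (alignWith h as bs) x ≡ horner f as x + horner g bs x
horner-alignWith f g e h eh [] bs x =
  trans (horner-map e (h ∘ that) bs x) (horner-cong (eh ∘ that) bs x)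
horner-alignWith f g e h eh as@(_ ∷ _) [] x =
  trans (trans (horner-map e (h ∘ this) as x) (horner-cong (eh ∘ this) as x))
        (sym (+-identityʳ _))
horner-alignWith f g e h eh (a ∷ as) (b ∷ bs) x =
  trans (cong₂ (λ u v → u + x * v) (eh (these a b)) (horner-alignWith f g e h eh as bs x))
        (interchange (f a) (g b) x (horner f as x) (horner g bs x))
  where
  interchange : ∀ u w x v y → u + w + x * (v + y) ≡ u + x * v + (w + x * y)
  interchange = solve-∀

-- Polynomials in variable zero, the constant coefficient first.

Poly : ℕ → Set
Poly m = List (Term m)

infixl 6 _⊕_
infixl 7 _⊗_

_⊕_ : Poly m → Poly m → Poly m
_⊕_ = alignWith (These.fold id id _+ᵗ_)

_⊗_ : Poly m → Poly m → Poly m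
[]      ⊗ q = []
(a ∷ p) ⊗ q = map (a *ᵗ_) q ⊕ (0ᵗ ∷ p ⊗ q)

poly : Term (suc m) → Poly m
poly (var zero)    = 0ᵗ ∷ 1ᵗ ∷ []
poly (var (suc i)) = var i ∷ []
poly 0ᵗ            = []
poly 1ᵗ            = 1ᵗ ∷ []
poly (s +ᵗ t)      = poly s ⊕ poly t
poly (s *ᵗ t)      = poly s ⊗ poly t

value : Vec ℕ m → Term m → ℕ
value ν t = ⟦ t ⟧ ν

module _ (ν : Vec ℕ m) where

  horner-⊕ : ∀ p q x → horner (value ν) (p ⊕ q) x ≡ horner (value ν) p x + horner (value ν) q x
  horner-⊕ = horner-alignWith (value ν) (value ν) (value ν) _ λ where
    (this _)    → refl
    (that _)    → refl
    (these _ _) → refl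

  horner-⊗ : ∀ p q x → horner (value ν) (p ⊗ q) x ≡ horner (value ν) p x * horner (value ν) q x
  horner-⊗ []      q x = refl
  horner-⊗ (a ∷ p) q x = begin
    horner (value ν) (map (a *ᵗ_) q ⊕ (0ᵗ ∷ p ⊗ q)) x
      ≡⟨ horner-⊕ (map (a *ᵗ_) q) (0ᵗ ∷ p ⊗ q) x ⟩
    -- Prefixing `0ᵗ` multiplies by `x`; its own summand 0 disappears by computation.
    horner (value ν) (map (a *ᵗ_) q) x + x * horner (value ν) (p ⊗ q) x
      ≡⟨ cong₂ (λ u v → u + x * v)
           (trans (horner-map (value ν) (a *ᵗ_) q x) (horner-scale (⟦ a ⟧ ν) (value ν) q x))
           (horner-⊗ p q x) ⟩
    ⟦ a ⟧ ν * H q + x * (H p * H q)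
      ≡⟨ factor (⟦ a ⟧ ν) (H q) x (H p) ⟩
    (⟦ a ⟧ ν + x * H p) * H q ∎
    where
    open ≡-Reasoning
    H : Poly m → ℕ
    H r = horner (value ν) r x
    factor : ∀ u w x v → u * w + x * (v * w) ≡ (u + x * v) * w
    factor = solve-∀

  horner-poly : ∀ t x → horner (value ν) (poly t) x ≡ ⟦ t ⟧ (x ∷ ν)
  horner-poly (var zero)    x = linear x
    where
    linear : ∀ x → x * (1 + x * 0) ≡ x
    linear = solve-∀
  horner-poly (var (suc i)) x = trans (cong (lookup ν i +_) (*-zeroʳ x)) (+-identityʳ _)
  horner-poly 0ᵗ            x = refl
  horner-poly 1ᵗ            x = cong suc (*-zeroʳ x)
  horner-poly (s +ᵗ t)      x =
    trans (horner-⊕ (poly s) (poly t) x) (cong₂ _+_ (horner-poly s x) (horner-poly t x))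
  horner-poly (s *ᵗ t)      x =
    trans (horner-⊗ (poly s) (poly t) x) (cong₂ _*_ (horner-poly s x) (horner-poly t x))

-- A list of pairs of terms stands for two polynomials padded to a common length.

paired : Poly m → Poly m → List (Term m × Term m)
paired = alignWith (These.foldWithDefaults 0ᵗ 0ᵗ _,_)

equal : List (Term m × Term m) → Formula m
equal []            = 0ᵗ ≈ᶠ 0ᵗ
equal ((a , b) ∷ r) = a ≈ᶠ b ∧ᶠ equal r

-- The head pair holds the constant coefficients, so the tail is consulted first. The formula
-- `0ᵗ <ᶠ 0ᵗ` stands for falsity, just as `0ᵗ ≈ᶠ 0ᵗ` in `equal` stands for truth.
less : List (Term m × Term m) → Formula m
less []            = 0ᵗ <ᶠ 0ᵗ
less ((a , b) ∷ r) = less r ∨ᶠ equal r ∧ᶠ a <ᶠ b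

equal-qf : (r : List (Term m × Term m)) → QuantifierFree (equal r)
equal-qf []            = 0ᵗ ≈ᶠ 0ᵗ
equal-qf ((a , b) ∷ r) = (a ≈ᶠ b) ∧ᶠ equal-qf r

less-qf : (r : List (Term m × Term m)) → QuantifierFree (less r)
less-qf []            = 0ᵗ <ᶠ 0ᵗ
less-qf ((a , b) ∷ r) = less-qf r ∨ᶠ (equal-qf r ∧ᶠ (a <ᶠ b))

-- Asymptotic comparison of two polynomials.

horner-const-0 : ∀ (as : List A) x → horner (const 0) as x ≡ 0
horner-const-0 []       x = refl
horner-const-0 (_ ∷ as) x = trans (cong (x *_) (horner-const-0 as x)) (*-zeroʳ x)

-- The gap between `f x` and `g x` is at least 1, so multiplication by `x` makes it at least `x`,
-- which outweighs `a` as soon as `a < x`.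
eventually-<-step : ∀ a b {f g : ℕ → ℕ} → Eventually (λ x → f x < g x) →
  Eventually (λ x → a + x * f x < b + x * g x)
eventually-<-step a b {f} {g} f<g = eventually-zip step f<g (beyond a λ _ a<x → a<x)
  where
  open ≤-Reasoning
  step : ∀ x → f x < g x → a < x → a + x * f x < b + x * g x
  step x fx<gx a<x = begin-strict
    a + x * f x   <⟨ +-monoˡ-< (x * f x) a<x ⟩
    x + x * f x   ≡⟨ *-suc x (f x) ⟨
    x * suc (f x) ≤⟨ *-monoʳ-≤ x fx<gx ⟩
    x * g x       ≤⟨ m≤n+m (x * g x) b ⟩
    b + x * g x   ∎

module _ (ν : Vec ℕ m) where

  left right : List (Term m × Term m) → ℕ → ℕ
  left  = horner (value ν ∘ proj₁)
  right = horner (value ν ∘ proj₂)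

  left-paired : ∀ p q x → left (paired p q) x ≡ horner (value ν) p x
  left-paired p q x =
    -- Evaluating the other polynomial by `const 0` makes the first components a coefficientwise sum
    -- whose second summand vanishes.
    trans (horner-alignWith (value ν) (const 0) (value ν ∘ proj₁) _
            (λ { (this _) → refl ; (that _) → refl ; (these _ _) → sym (+-identityʳ _) }) p q x)
          (trans (cong (horner (value ν) p x +_) (horner-const-0 q x)) (+-identityʳ _))

  right-paired : ∀ p q x → right (paired p q) x ≡ horner (value ν) q x
  right-paired p q x =
    trans (horner-alignWith (const 0) (value ν) (value ν ∘ proj₂) _
            (λ { (this _) → refl ; (that _) → refl ; (these _ _) → refl }) p q x)
          (cong (_+ horner (value ν) q x) (horner-const-0 p x))

  equal-sound : ∀ r → ν ⊨ equal r → ∀ x → left r x ≡ right r x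
  equal-sound []            _           x = refl
  equal-sound ((a , b) ∷ r) (a≡b , r≡) x =
    cong₂ (λ u v → u + x * v) a≡b (equal-sound r r≡ x)

  <-constant : ∀ {a b} {f g : ℕ → ℕ} → (∀ x → f x ≡ g x) → a < b →
    Eventually (λ x → a + x * f x < b + x * g x)
  <-constant {a} {b} {f} {g} f≗g a<b = always λ x →
    subst (λ v → a + x * f x < b + x * v) (f≗g x) (+-monoˡ-< (x * f x) a<b)

  less-sound : ∀ r → ν ⊨ less r → Eventually (λ x → left r x < right r x)
  less-sound ((a , b) ∷ r) (inj₁ r<)        = eventually-<-step (⟦ a ⟧ ν) (⟦ b ⟧ ν) (less-sound r r<)
  less-sound ((a , b) ∷ r) (inj₂ (r≡ , a<b)) = <-constant (equal-sound r r≡) a<b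

  -- The three eventual outcomes exclude one another, so deciding which one occurs yields the
  -- converses of `equal-sound` and `less-sound`. The third outcome serves only for refutation and
  -- is therefore given without a formula.
  trichotomy : ∀ r → (ν ⊨ equal r) ⊎ (ν ⊨ less r) ⊎ Eventually (λ x → right r x < left r x)
  trichotomy [] = inj₁ refl
  trichotomy ((a , b) ∷ r) with trichotomy r
  ... | inj₂ (inj₁ r<) = inj₂ (inj₁ (inj₁ r<))
  ... | inj₂ (inj₂ r>) = inj₂ (inj₂ (eventually-<-step (⟦ b ⟧ ν) (⟦ a ⟧ ν) r>))
  ... | inj₁ r≡ with <-cmp (⟦ a ⟧ ν) (⟦ b ⟧ ν)
  ...   | tri< a<b _ _ = inj₂ (inj₁ (inj₂ (r≡ , a<b)))
  ...   | tri≈ _ a≡b _ = inj₁ (a≡b , r≡)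
  ...   | tri> _ _ b<a = inj₂ (inj₂ (<-constant (sym ∘ equal-sound r r≡) b<a))

  equal-limit : ∀ r → Eventually (λ x → (left r x ≡ right r x) ⇔ (ν ⊨ equal r))
  equal-limit r with trichotomy r
  ... | inj₁ r≡        = always λ x → mk⇔ (const r≡) (const (equal-sound r r≡ x))
  ... | inj₂ (inj₁ r<) = eventually-map
    (λ x l<r → mk⇔ (λ l≡r → ⊥-elim (<-irrefl l≡r l<r)) (λ r≡ → equal-sound r r≡ x))
    (less-sound r r<)
  ... | inj₂ (inj₂ r>) = eventually-map
    (λ x r<l → mk⇔ (λ l≡r → ⊥-elim (<-irrefl (sym l≡r) r<l)) (λ r≡ → equal-sound r r≡ x))
    r>

  less-limit : ∀ r → Eventually (λ x → (left r x < right r x) ⇔ (ν ⊨ less r))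
  less-limit r with trichotomy r
  ... | inj₁ r≡        = always λ x → mk⇔
    (λ l<r → ⊥-elim (<-irrefl (equal-sound r r≡ x) l<r))
    -- The formula gives the strict inequality only for large arguments, so the clash with equality
    -- is sought at some large `y`, not at the given `x`.
    (λ r< → ⊥-elim (eventually-const
      (eventually-map (λ y → <-irrefl (equal-sound r r≡ y)) (less-sound r r<))))
  ... | inj₂ (inj₁ r<) = eventually-map (λ x l<r → mk⇔ (const r<) (const l<r)) (less-sound r r<)
  ... | inj₂ (inj₂ r>) = eventually-map
    (λ x r<l → mk⇔
      (λ l<r → ⊥-elim (<-asym l<r r<l))
      (λ r< → ⊥-elim (eventually-const (eventually-zip (λ _ → <-asym) r> (less-sound r r<)))))
    r>

-- Limits of quantifier-free formulas.

limit : {φ : Formula (suc m)} → QuantifierFree φ → Formula m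
limit (s ≈ᶠ t) = equal (paired (poly s) (poly t))
limit (s <ᶠ t) = less (paired (poly s) (poly t))
limit (¬ᶠ φ)   = ¬ᶠ limit φ
limit (φ ∧ᶠ ψ) = limit φ ∧ᶠ limit ψ
limit (φ ∨ᶠ ψ) = limit φ ∨ᶠ limit ψ
limit (φ ⇒ᶠ ψ) = limit φ ⇒ᶠ limit ψ
limit (φ ⇔ᶠ ψ) = limit φ ⇔ᶠ limit ψ

limit-qf : {φ : Formula (suc m)} (φ-qf : QuantifierFree φ) → QuantifierFree (limit φ-qf)
limit-qf (s ≈ᶠ t) = equal-qf (paired (poly s) (poly t))
limit-qf (s <ᶠ t) = less-qf (paired (poly s) (poly t))
limit-qf (¬ᶠ φ)   = ¬ᶠ limit-qf φ
limit-qf (φ ∧ᶠ ψ) = limit-qf φ ∧ᶠ limit-qf ψ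
limit-qf (φ ∨ᶠ ψ) = limit-qf φ ∨ᶠ limit-qf ψ
limit-qf (φ ⇒ᶠ ψ) = limit-qf φ ⇒ᶠ limit-qf ψ
limit-qf (φ ⇔ᶠ ψ) = limit-qf φ ⇔ᶠ limit-qf ψ

module _ (ν : Vec ℕ m) where

  -- An equation between types for an arbitrary relation, so that one `subst` handles both kinds of
  -- atomic formula.
  paired-poly : ∀ (_~_ : ℕ → ℕ → Set) s t x →
    let r = paired (poly s) (poly t) in
    (left ν r x ~ right ν r x) ≡ (⟦ s ⟧ (x ∷ ν) ~ ⟦ t ⟧ (x ∷ ν))
  paired-poly _~_ s t x = cong₂ _~_
    (trans (left-paired ν (poly s) (poly t) x) (horner-poly ν s x))
    (trans (right-paired ν (poly s) (poly t) x) (horner-poly ν t x))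

  -- Eventual truth alone does not commute with negation or disjunction. Eventual equivalence with a
  -- statement free of `x` passes through every connective, at the maximum of the bounds.
  limit-correct : {φ : Formula (suc m)} (φ-qf : QuantifierFree φ) →
    Eventually (λ x → (x ∷ ν ⊨ φ) ⇔ (ν ⊨ limit φ-qf))
  limit-correct (s ≈ᶠ t) =
    eventually-map (λ x → subst (_⇔ _) (paired-poly _≡_ s t x)) (equal-limit ν _)
  limit-correct (s <ᶠ t) =
    eventually-map (λ x → subst (_⇔ _) (paired-poly _<_ s t x)) (less-limit ν _)
  limit-correct (¬ᶠ φ)   = eventually-map (λ _ → ¬-cong-⇔) (limit-correct φ)
  limit-correct (φ ∧ᶠ ψ) = eventually-zip (λ _ → _×-⇔_) (limit-correct φ) (limit-correct ψ)
  limit-correct (φ ∨ᶠ ψ) = eventually-zip (λ _ → _⊎-⇔_) (limit-correct φ) (limit-correct ψ)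
  limit-correct (φ ⇒ᶠ ψ) = eventually-zip (λ _ → →-cong-⇔) (limit-correct φ) (limit-correct ψ)
  limit-correct (φ ⇔ᶠ ψ) = eventually-zip (λ _ → Related-cong) (limit-correct φ) (limit-correct ψ)

-- Elimination of `Q` and decidability.

Q-limit : ∀ (φ : Formula (suc m)) ν →
  Eventually (λ x → (x ∷ ν ⊨ φ) ⇔ A) → (ν ⊨ Q φ) ⇔ A
Q-limit φ ν φ⇔A = mk⇔
  (λ (z , p) → eventually-const (eventually-zip (λ _ → Equivalence.to) φ⇔A (beyond z p)))
  -- The bound of the equivalence itself is the witness for `Q`.
  (λ a → bound φ⇔A , λ x z<x → Equivalence.from (holds φ⇔A x z<x) a)
  where open Eventually

eliminate : (φ : Formula m) → ∃[ ψ ] (QuantifierFree ψ × (∀ (ν : Vec ℕ m) → (ν ⊨ φ) ⇔ (ν ⊨ ψ)))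
eliminate (s ≈ᶠ t) = _ , s ≈ᶠ t , λ _ → ⇔-id _
eliminate (s <ᶠ t) = _ , s <ᶠ t , λ _ → ⇔-id _
eliminate (¬ᶠ φ) with eliminate φ
... | _ , p , φ⇔ = _ , (¬ᶠ p) , λ ν → ¬-cong-⇔ (φ⇔ ν)
eliminate (φ ∧ᶠ ψ) with eliminate φ | eliminate ψ
... | _ , p , φ⇔ | _ , q , ψ⇔ = _ , (p ∧ᶠ q) , λ ν → φ⇔ ν ×-⇔ ψ⇔ ν
eliminate (φ ∨ᶠ ψ) with eliminate φ | eliminate ψ
... | _ , p , φ⇔ | _ , q , ψ⇔ = _ , (p ∨ᶠ q) , λ ν → φ⇔ ν ⊎-⇔ ψ⇔ ν
eliminate (φ ⇒ᶠ ψ) with eliminate φ | eliminate ψ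
... | _ , p , φ⇔ | _ , q , ψ⇔ = _ , (p ⇒ᶠ q) , λ ν → →-cong-⇔ (φ⇔ ν) (ψ⇔ ν)
eliminate (φ ⇔ᶠ ψ) with eliminate φ | eliminate ψ
... | _ , p , φ⇔ | _ , q , ψ⇔ = _ , (p ⇔ᶠ q) , λ ν → Related-cong (φ⇔ ν) (ψ⇔ ν)
-- Quantifiers go from the inside out. The equivalence for the body holds at every `x ∷ ν`, so
-- composing with it keeps the bound from `limit-correct`.
eliminate (Q φ) with eliminate φ
... | _ , p , φ⇔ = limit p , limit-qf p , λ ν → Q-limit φ ν
  (eventually-map (λ x ψ⇔ → ψ⇔ ⇔-∘ φ⇔ (x ∷ ν)) (limit-correct ν p))

qf-decidable : {φ : Formula m} → QuantifierFree φ → (ν : Vec ℕ m) → Dec (ν ⊨ φ)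
qf-decidable (s ≈ᶠ t) ν = ⟦ s ⟧ ν ≟ ⟦ t ⟧ ν
qf-decidable (s <ᶠ t) ν = ⟦ s ⟧ ν <? ⟦ t ⟧ ν
qf-decidable (¬ᶠ φ)   ν = ¬? (qf-decidable φ ν)
qf-decidable (φ ∧ᶠ ψ) ν = qf-decidable φ ν ×-dec qf-decidable ψ ν
qf-decidable (φ ∨ᶠ ψ) ν = qf-decidable φ ν ⊎-dec qf-decidable ψ ν
qf-decidable (φ ⇒ᶠ ψ) ν = qf-decidable φ ν →-dec qf-decidable ψ ν
qf-decidable (φ ⇔ᶠ ψ) ν = Dec.map′ (λ (f , g) → mk⇔ f g) (λ e → Equivalence.to e , Equivalence.from e)
  ((qf-decidable φ ν →-dec qf-decidable ψ ν) ×-dec (qf-decidable ψ ν →-dec qf-decidable φ ν))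

corollary2p2 : Decidable TheoryOfℕ
    × (∀ (m : ℕ) (φ : Formula m) →
    ∃[ ψ ] (QuantifierFree ψ × (∀ (ν : Vec ℕ m) → (ν ⊨ φ) ⇔ (ν ⊨ ψ))))
corollary2p2 = decide , λ _ → eliminate
  where
  decide : Decidable TheoryOfℕ
  decide φ with eliminate φ
  -- The equivalent formula is again a sentence, so its truth under `[]` is settled by computing
  -- closed terms.
  ... | _ , ψ-qf , φ⇔ψ = Dec.map (⇔-sym (φ⇔ψ [])) (qf-decidable ψ-qf [])
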